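{- Let $G$ be a countable graph. The following are equivalent: (i) there exists a countable graph $G'$ such that $G$ and $G'$ are independent, i.e. $G \not\to G'$ and $G' \not\to G$; (ii) $G$ is not bipartite and $G$ does not contain $K_\omega$ as a subgraph.
   Context: All graphs are simple, undirected and loopless. A homomorphism $f: G \to G'$ is a map $V(G) \to V(G')$ such that $\{x,y\} \in E(G)$ implies $\{f(x),f(y)\} \in E(G')$. We write $G \to G'$ (or $G \le G'$) if a homomorphism exists, and $G \not\to G'$ otherwise. $K_\omega$ denotes the countably infinite complete graph. A set of graphs is independent if there is no homomorphism between any two distinct members of the set. -}

module Defs where

open import Level using (0ℓ)
open import Data.Bool.Base using (Bool)
open import Data.Nat.Base using (ℕ)
open import Data.Product.Base using (Σ; _×_)
open import Function.Base using (_∘_)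
open import Function.Bundles using (_↣_)
open import Function.Definitions using (Injective)
open import Relation.Binary.Core using (Rel)
open import Relation.Binary.Definitions using (Symmetric)
open import Relation.Binary.PropositionalEquality using (_≡_; _≢_; refl; sym)
open import Relation.Nullary.Negation using (¬_)

record Graph : Set₁ where
  field
    Vertex   : Set
    Edge     : Rel Vertex 0ℓ
    edge-sym : Symmetric Edge
    loopless : ∀ x → ¬ Edge x x

open Graph public

-- Finite graphs, including the empty graph, count as countable.
Countable : Graph → Set
Countable G = Vertex G ↣ ℕ

IsHom : (G H : Graph) → (Vertex G → Vertex H) → Set
IsHom G H f = ∀ {x y} → Edge G x y → Edge H (f x) (f y)

infix 4 _⟶_ _⟶̸_

_⟶_ : Graph → Graph → Set
G ⟶ H = Σ (Vertex G → Vertex H) (IsHom G H)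

_⟶̸_ : Graph → Graph → Set
G ⟶̸ H = ¬ (G ⟶ H)

Independent : Graph → Graph → Set
Independent G H = (G ⟶̸ H) × (H ⟶̸ G)

-- The two parts of the bipartition are the fibres of the colouring;
-- either of them may be empty.
Bipartite : Graph → Set
Bipartite G = Σ (Vertex G → Bool) λ c → ∀ {x y} → Edge G x y → c x ≢ c y

-- H is isomorphic to a (not necessarily induced) subgraph of G.
ContainsSubgraph : (G H : Graph) → Set
ContainsSubgraph G H =
  Σ (Vertex H → Vertex G) λ f → Injective _≡_ _≡_ f × IsHom H G f

Kω : Graph
Kω = record
  { Vertex   = ℕ
  ; Edge     = _≢_
  ; edge-sym = λ x≢y → x≢y ∘ sym
  ; loopless = λ x x≢x → x≢x refl
  }

{-# OPTIONS --safe #-}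
-- Suppose G is not bipartite and does not contain Kω.  Let T be the graph of
-- finite cliques of G listed in some order, two of them adjacent when one
-- properly extends the other.  A homomorphism f : T → G would build an infinite
-- clique of G by repeatedly extending a list s by f s, so T ↛ G.  If G ↛ T,
-- then T is the required partner.
--
-- Otherwise G → T, and any graph of larger odd girth than G which has no
-- homomorphism to T is a partner.  The shift graph on increasing r-tuples of
-- natural numbers is one.  Its odd girth is large because on a short walk the
-- middle entry of the tuple survives, and its position changes parity at each
-- step.  For a homomorphism to T, Ramsey's theorem gives a sequence along whose
-- windows the images either always get longer, yielding an infinite clique of G,
-- or always get shorter, which is absurd.
module Submission where

open import Level using (0ℓ)
open import Axiom.ExcludedMiddle using (ExcludedMiddle)
open import Data.Bool.Base using (Bool; true; false; if_then_else_)
open import Data.Bool.Properties using (¬-not)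
open import Data.Empty using (⊥-elim)
open import Data.List.Base using (List; []; _∷_; length; map; applyUpTo)
open import Data.List.Membership.Propositional using (_∈_)
open import Data.List.Properties using (map-injective)
open import Data.List.Relation.Unary.All as All using (All; []; _∷_)
open import Data.List.Relation.Unary.AllPairs using (AllPairs; []; _∷_)
open import Data.List.Relation.Unary.Any using (here; there)
open import Data.Nat.Base using (ℕ; zero; suc; pred; parity; >-nonZero; _+_; _*_; _≤_; _<_)
open import Data.Nat.Base using (z≤n; s≤s; z<s; s<s; s<s⁻¹; s≤s⁻¹)
open import Data.Nat.Induction using (<-rec)
open import Data.Nat.Properties
open import Data.Parity.Base as ℙ using (0ℙ; 1ℙ)
open import Data.Parity.Properties using (+-homo-+; p+p≡0ℙ)
open import Data.Product using (Σ; Σ-syntax; ∃-syntax; _×_; _,_; proj₁; proj₂)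
open import Data.Sum.Base using (_⊎_; inj₁; inj₂; [_,_]′; swap)
open import Function.Base using (_∘_; id; const)
open import Function.Bundles using (_⇔_; mk⇔; _↣_; mk↣; module Injection)
open import Function.Definitions using (Injective)
open import Relation.Binary.Definitions using (tri<; tri≈; tri>)
open import Relation.Binary.PropositionalEquality using (_≡_; _≢_; refl; sym; trans; cong; cong₂; subst; subst₂)
open import Relation.Nullary using (¬_; does; yes; no; contradiction)
open import Relation.Nullary.Decidable using (dec-true; dec-false)
open import Defs

-- Strictly increasing sequences

StrictMono : (ℕ → ℕ) → Set
StrictMono g = ∀ {i j} → i < j → g i < g j

increasing-below : ∀ (g : ℕ → ℕ) r → (∀ {i} → suc i < r → g i < g (suc i)) →
                   ∀ {i j} → i < j → j < r → g i < g j
increasing-below g r step {i} {suc j} i<1+j 1+j<r with m≤n⇒m<n∨m≡n (s≤s⁻¹ i<1+j)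
... | inj₁ i<j  = <-trans (increasing-below g r step i<j (<-trans (n<1+n j) 1+j<r)) (step 1+j<r)
... | inj₂ refl = step 1+j<r

strictMono : ∀ {g : ℕ → ℕ} → (∀ i → g i < g (suc i)) → StrictMono g
strictMono {g} step {j = j} i<j = increasing-below g (suc j) (λ {i} _ → step i) i<j (n<1+n j)

shift-down : ∀ {v} → StrictMono v → 0 < v 0 →
             Σ[ v′ ∈ (ℕ → ℕ) ] StrictMono v′ × (∀ i → v i ≡ suc (v′ i))
shift-down {v} v-mono 0<v₀ =
  pred ∘ v , (λ {i} {j} i<j → s<s⁻¹ (subst₂ _<_ (v≡ i) (v≡ j) (v-mono i<j))) , v≡
  where
  0<v : ∀ i → 0 < v i
  0<v zero    = 0<v₀
  0<v (suc i) = ≤-<-trans z≤n (v-mono {0} z<s)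

  v≡ : ∀ i → v i ≡ suc (pred (v i))
  v≡ i = sym (suc-pred (v i) ⦃ >-nonZero (0<v i) ⦄)

no-infinite-descent : (g : ℕ → ℕ) → ¬ (∀ i → g (suc i) < g i)
no-infinite-descent g desc = <-irrefl refl (≤-trans (m≤m+n _ _) (bound (suc (g 0))))
  where
  bound : ∀ i → i + g i ≤ g 0
  bound zero    = ≤-refl
  bound (suc i) = ≤-trans (≤-reflexive (sym (+-suc i _))) (≤-trans (+-monoʳ-≤ i (desc i)) (bound i))

-- Injective codes for lists

-- The pairing 2^x (2n + 1); it never takes the value 0, which is left for the empty list.
tag : ℕ → ℕ → ℕ
tag zero    n = suc (2 * n)
tag (suc x) n = 2 * tag x n

tag≢0 : ∀ x {n} → tag x n ≢ 0
tag≢0 (suc x) eq = tag≢0 x (*-cancelˡ-≡ _ 0 2 eq)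

tag-injective : ∀ x y {m n} → tag x m ≡ tag y n → x ≡ y × m ≡ n
tag-injective zero    zero    eq = refl , *-cancelˡ-≡ _ _ 2 (suc-injective eq)
tag-injective zero    (suc y) {m} {n} eq = contradiction (sym eq) (even≢odd (tag y n) m)
tag-injective (suc x) zero    {m} {n} eq = contradiction eq (even≢odd (tag x m) n)
tag-injective (suc x) (suc y) eq with tag-injective x y (*-cancelˡ-≡ _ _ 2 eq)
... | x≡y , m≡n = cong suc x≡y , m≡n

encode : List ℕ → ℕ
encode []       = 0
encode (x ∷ xs) = tag x (encode xs)

encode-injective : Injective _≡_ _≡_ encode
encode-injective {[]}     {[]}     eq = refl
encode-injective {[]}     {y ∷ ys} eq = contradiction (sym eq) (tag≢0 y)
encode-injective {x ∷ xs} {[]}     eq = contradiction eq (tag≢0 x)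
encode-injective {x ∷ xs} {y ∷ ys} eq with tag-injective x y eq
... | x≡y , codes≡ = cong₂ _∷_ x≡y (encode-injective codes≡)

List-countable : ∀ {A : Set} → A ↣ ℕ → List A ↣ ℕ
List-countable i = mk↣ {to = encode ∘ map (Injection.to i)}
  (map-injective (Injection.injective i) ∘ encode-injective)

-- Homomorphisms and infinite cliques

⟶-trans : ∀ {G H K} → G ⟶ H → H ⟶ K → G ⟶ K
⟶-trans (f , f-hom) (g , g-hom) = g ∘ f , g-hom ∘ f-hom

countable⟶Kω : ∀ {G} → Countable G → G ⟶ Kω
countable⟶Kω {G} i = to , λ {x} e eq → loopless G x (subst (Edge G x) (sym (injective eq)) e)
  where open Injection i

infinite-clique : ∀ (G : Graph) (x : ℕ → Vertex G) → (∀ {m n} → m < n → Edge G (x n) (x m)) →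
                  ContainsSubgraph G Kω
infinite-clique G x adj = x , x-injective , x-hom
  where
  x-hom : IsHom Kω G x
  x-hom {m} {n} m≢n with <-cmp m n
  ... | tri< m<n _ _ = edge-sym G (adj m<n)
  ... | tri≈ _ m≡n _ = contradiction m≡n m≢n
  ... | tri> _ _ n<m = adj n<m

  -- Equal values at distinct indices would put a loop on a vertex.
  x-injective : Injective _≡_ _≡_ x
  x-injective {m} {n} eq with m ≟ n
  ... | yes m≡n = m≡n
  ... | no  m≢n = contradiction (subst (Edge G (x m)) (sym eq) (x-hom m≢n)) (loopless G (x m))

-- Walks and bipartiteness

data Walk (G : Graph) : ℕ → Vertex G → Vertex G → Set where
  []  : ∀ {x} → Walk G 0 x x
  _∷_ : ∀ {n x y z} → Edge G x y → Walk G n y z → Walk G (suc n) x z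

module _ {G : Graph} where

  infixr 5 _++ʷ_

  _++ʷ_ : ∀ {m n x y z} → Walk G m x y → Walk G n y z → Walk G (m + n) x z
  []      ++ʷ q = q
  (e ∷ p) ++ʷ q = e ∷ (p ++ʷ q)

  snocʷ : ∀ {n x y z} → Walk G n x y → Edge G y z → Walk G (suc n) x z
  snocʷ []      e = e ∷ []
  snocʷ (d ∷ p) e = d ∷ snocʷ p e

  reverseʷ : ∀ {n x y} → Walk G n x y → Walk G n y x
  reverseʷ []      = []
  reverseʷ (e ∷ p) = snocʷ (reverseʷ p) (edge-sym G e)

mapʷ : ∀ {G H n x y} ((f , _) : G ⟶ H) → Walk G n x y → Walk H n (f x) (f y)
mapʷ h []      = []
mapʷ h (e ∷ p) = proj₂ h e ∷ mapʷ h p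

OddClosedWalk : Graph → Set
OddClosedWalk G = ∃[ n ] ∃[ x ] Walk G n x x × parity n ≡ 1ℙ

parity-suc-even : ∀ n → parity n ≡ 0ℙ → parity (suc n) ≡ 1ℙ
parity-suc-even zero          _  = refl
parity-suc-even (suc (suc n)) eq = parity-suc-even n eq

parity-suc-odd : ∀ n → parity n ≡ 1ℙ → parity (suc n) ≡ 0ℙ
parity-suc-odd (suc zero)    _  = refl
parity-suc-odd (suc (suc n)) eq = parity-suc-odd n eq

module Classical (em : ExcludedMiddle 0ℓ) where

  Least : (ℕ → Set) → ℕ → Set
  Least P m = P m × (∀ {k} → P k → m ≤ k)

  least : ∀ (P : ℕ → Set) {n} → P n → ∃[ m ] Least P m
  least P {n} = <-rec (λ n → P n → ∃[ m ] Least P m) step n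
    where
    step : ∀ n → (∀ {k} → k < n → P k → ∃[ m ] Least P m) → P n → ∃[ m ] Least P m
    step n rec Pn with em {∃[ k ] k < n × P k}
    ... | yes (_ , k<n , Pk) = rec k<n Pk
    ... | no  none           = n , Pn , λ {k} Pk → ≮⇒≥ λ k<n → none (k , k<n , Pk)

  -- Each component is coloured by parity of distance from its vertex of least code.
  odd-closed-walk : ∀ (G : Graph) → Countable G → ¬ Bipartite G → OddClosedWalk G
  odd-closed-walk G countable ¬bipartite with em {OddClosedWalk G}
  ... | yes walk = walk
  ... | no  none = ⊥-elim (¬bipartite (colour , colour-proper))
    where
    open Injection countable

    Code : Vertex G → ℕ → Set
    Code x m = ∃[ y ] to y ≡ m × ∃[ n ] Walk G n y x

    extend : ∀ {x x′ m} → Edge G x x′ → Code x m → Code x′ m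
    extend e (y , code , n , p) = y , code , suc n , snocʷ p e

    least-code : ∀ x → ∃[ m ] Least (Code x) m
    least-code x = least (Code x) (x , refl , 0 , [])

    base : Vertex G → Vertex G
    base x = proj₁ (proj₁ (proj₂ (least-code x)))

    base-walk : ∀ x → ∃[ n ] Walk G n (base x) x
    base-walk x = proj₂ (proj₂ (proj₁ (proj₂ (least-code x))))

    -- Adjacent vertices are reachable from the same vertices, so their least codes agree, and codes
    -- are injective.
    base-cong : ∀ {x x′} → Edge G x x′ → base x ≡ base x′
    base-cong {x} {x′} e with least-code x | least-code x′
    ... | m , Pm@(_ , refl , _) , min | m′ , Pm′@(_ , refl , _) , min′ =
      injective (≤-antisym (min (extend (edge-sym G e) Pm′)) (min′ (extend e Pm)))

    EvenWalk : Vertex G → Set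
    EvenWalk x = ∃[ n ] Walk G n (base x) x × parity n ≡ 0ℙ

    colour : Vertex G → Bool
    colour x = does (em {EvenWalk x})

    colour-proper : ∀ {x y} → Edge G x y → colour x ≢ colour y
    colour-proper {x} {y} e with em {EvenWalk x} | em {EvenWalk y}
    ... | yes _ | no _ = λ ()
    ... | no _ | yes _ = λ ()
    ... | yes (m , p , m-even) | yes (n , q , n-even) = contradiction
      (suc (n + m) , x , closed-walk , parity-suc-even (n + m) n+m-even) none
      where
      closed-walk : Walk G (suc (n + m)) x x
      -- Cross to `y`, return to the common base, then walk out to `x`.
      closed-walk = e ∷ (reverseʷ q ++ʷ subst (λ b → Walk G m b x) (base-cong e) p)

      n+m-even : parity (n + m) ≡ 0ℙ
      n+m-even = trans (+-homo-+ n m) (cong₂ ℙ._+_ n-even m-even)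
    -- An odd walk to `x` followed by the edge is an even walk to `y`.
    ... | no ¬even-x | no ¬even-y with base-walk x
    ... | n , p with parity n in n-parity
    ... | 0ℙ = contradiction (n , p , n-parity) ¬even-x
    ... | 1ℙ = contradiction
      (suc n , subst (λ b → Walk G (suc n) b y) (base-cong e) (snocʷ p e) , parity-suc-odd n n-parity)
      ¬even-y

  -- Ramsey's theorem

  DependsOnFirst : ℕ → ((ℕ → ℕ) → Bool) → Set
  DependsOnFirst n c = ∀ {u v} → (∀ {i} → i < n → u i ≡ v i) → c u ≡ c v

  -- A colouring of increasing n-tuples is encoded as a colouring of sequences
  -- that looks only at the first n entries.
  Ramsey : ℕ → Set
  Ramsey n = ∀ c → DependsOnFirst n c →
    Σ[ g ∈ (ℕ → ℕ) ] StrictMono g × Σ[ b ∈ Bool ] (∀ {v} → StrictMono v → c (g ∘ v) ≡ b)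

  -- Infinite pigeonhole: unless `β` is eventually `true`, it is `false` arbitrarily late.
  constant-subsequence : (β : ℕ → Bool) →
    Σ[ p ∈ (ℕ → ℕ) ] StrictMono p × Σ[ b ∈ Bool ] (∀ i → β (p i) ≡ b)
  constant-subsequence β with em {∃[ N ] (∀ m → N ≤ m → β m ≡ true)}
  ... | yes (N , eventually) = (N +_) , +-monoʳ-< N , true , λ i → eventually (N + i) (m≤m+n N i)
  ... | no never = p , strictMono p-step , false , p-false
    where
    later : ∀ N → ∃[ m ] N ≤ m × β m ≡ false
    later N with em {∃[ m ] N ≤ m × β m ≡ false}
    ... | yes found = found
    ... | no none = contradiction
      (N , λ m N≤m → ¬-not λ m-false → none (m , N≤m , m-false)) never

    p : ℕ → ℕ
    p zero    = proj₁ (later 0)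
    p (suc i) = proj₁ (later (suc (p i)))

    p-step : ∀ i → p i < p (suc i)
    p-step i = proj₁ (proj₂ (later (suc (p i))))

    p-false : ∀ i → β (p i) ≡ false
    p-false zero    = proj₂ (proj₂ (later 0))
    p-false (suc i) = proj₂ (proj₂ (later (suc (p i))))

  infixr 5 _◂_

  _◂_ : ℕ → (ℕ → ℕ) → ℕ → ℕ
  (a ◂ v) zero    = a
  (a ◂ v) (suc i) = v i

  -- Here `h` enumerates the infinite set still available. Its first element is set aside and the
  -- rest is thinned out until all tuples beginning with that element have one colour. The elements
  -- set aside form the diagonal, where the colour of a tuple depends on its first entry only.
  module RamseyStep {n} (ramsey-n : Ramsey n)
                    (c : (ℕ → ℕ) → Bool) (local : DependsOnFirst (suc n) c) where

    colour-cong : ∀ {u v} → u 0 ≡ v 0 → (∀ {i} → i < n → u (suc i) ≡ v (suc i)) → c u ≡ c v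
    colour-cong {u} {v} head tail = local u≗v
      where
      u≗v : ∀ {i} → i < suc n → u i ≡ v i
      u≗v {zero}  _   = head
      u≗v {suc i} i<n = tail (s<s⁻¹ i<n)

    section : (ℕ → ℕ) → (ℕ → ℕ) → Bool
    section h v = c (h 0 ◂ h ∘ suc ∘ v)

    section-local : ∀ h → DependsOnFirst n (section h)
    section-local h u≗v = colour-cong refl λ i<n → cong (h ∘ suc) (u≗v i<n)

    refine : (ℕ → ℕ) → ℕ → ℕ
    refine h = proj₁ (ramsey-n (section h) (section-local h))

    refine-mono : ∀ h → StrictMono (refine h)
    refine-mono h = proj₁ (proj₂ (ramsey-n (section h) (section-local h)))

    next : (ℕ → ℕ) → ℕ → ℕ
    next h = h ∘ suc ∘ refine h

    diagonal : (ℕ → ℕ) → ℕ → ℕ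
    diagonal h zero    = h 0
    diagonal h (suc k) = diagonal (next h) k

    first-colour : (ℕ → ℕ) → ℕ → Bool
    first-colour h zero    = proj₁ (proj₂ (proj₂ (ramsey-n (section h) (section-local h))))
    first-colour h (suc k) = first-colour (next h) k

    -- The position of each diagonal entry within `h`. For `id` it yields monotonicity; for `next h`
    -- it shows that later diagonal entries stay inside the thinned set.
    index : (ℕ → ℕ) → ℕ → ℕ
    index h zero    = 0
    index h (suc k) = suc (refine h (index (next h) k))

    diagonal≡ : ∀ h k → diagonal h k ≡ h (index h k)
    diagonal≡ h zero    = refl
    diagonal≡ h (suc k) = diagonal≡ (next h) k

    index-mono : ∀ h → StrictMono (index h)
    index-mono h {zero}  {suc j} _   = z<s
    index-mono h {suc i} {suc j} i<j = s<s (refine-mono h (index-mono (next h) (s<s⁻¹ i<j)))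

    -- At `k = 0` this is homogeneity of the first thinning; for larger `k`, pass to `next h` and
    -- lower every index by one.
    diagonal-colour : ∀ h k {v} → StrictMono v → k < v 0 →
                      c (diagonal h k ◂ diagonal h ∘ v) ≡ first-colour h k
    diagonal-colour h k v-mono k<v₀ with shift-down v-mono (≤-<-trans z≤n k<v₀)
    diagonal-colour h zero {v} _ _ | v′ , v′-mono , v≡ = trans
      (colour-cong refl λ {i} _ → trans (cong (diagonal h) (v≡ i)) (diagonal≡ (next h) (v′ i)))
      (proj₂ (proj₂ (proj₂ (ramsey-n (section h) (section-local h)))) (index-mono (next h) ∘ v′-mono))
    diagonal-colour h (suc k) {v} _ k<v₀ | v′ , v′-mono , v≡ = trans
      (colour-cong refl λ {i} _ → cong (diagonal h) (v≡ i))
      (diagonal-colour (next h) k v′-mono (s<s⁻¹ (subst (suc k <_) (v≡ 0) k<v₀)))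

  ramsey : ∀ n → Ramsey n
  ramsey zero    c local = id , id , c id , λ _ → local λ ()
  ramsey (suc n) c local with constant-subsequence (first-colour id)
    where open RamseyStep (ramsey n) c local
  ... | p , p-mono , b , p-const = diagonal id ∘ p , diagonal-mono ∘ p-mono , b , homogeneous
    where
    open RamseyStep (ramsey n) c local

    diagonal-mono : StrictMono (diagonal id)
    diagonal-mono {i} {j} i<j =
      subst₂ _<_ (sym (diagonal≡ id i)) (sym (diagonal≡ id j)) (index-mono id i<j)

    -- The first entry decides the colour, and `p` keeps only diagonal entries deciding on `b`.
    homogeneous : ∀ {v} → StrictMono v → c (diagonal id ∘ p ∘ v) ≡ b
    homogeneous {v} v-mono = trans
      (colour-cong refl λ _ → refl)
      (trans (diagonal-colour id (p (v 0)) (p-mono ∘ v-mono ∘ s<s) (p-mono (v-mono z<s)))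
             (p-const (v 0)))

-- Trees of finite cliques

infix 4 _⊏_

-- The proper-suffix relation.
data _⊏_ {A : Set} (s : List A) : List A → Set where
  here  : ∀ {x} → s ⊏ x ∷ s
  there : ∀ {x t} → s ⊏ t → s ⊏ x ∷ t

⊏-length : ∀ {A : Set} {s t : List A} → s ⊏ t → length s < length t
⊏-length here      = n<1+n _
⊏-length (there p) = <-trans (⊏-length p) (n<1+n _)

⊏-∈ : ∀ {A : Set} {s t : List A} {x} → s ⊏ t → x ∈ s → x ∈ t
⊏-∈ here      x∈s = there x∈s
⊏-∈ (there p) x∈s = there (⊏-∈ p x∈s)

-- Of the new elements, the one directly in front of `s`.
added : ∀ {A : Set} {s t : List A} → s ⊏ t → A
added (here {x}) = x
added (there p)  = added p

added-∈ : ∀ {A : Set} {s t : List A} (p : s ⊏ t) → added p ∈ t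
added-∈ here      = here refl
added-∈ (there p) = there (added-∈ p)

Clique : (G : Graph) → List (Vertex G) → Set
Clique G = AllPairs (Edge G)

added-adjacent : ∀ {G s t} (p : s ⊏ t) → Clique G t → All (Edge G (added p)) s
added-adjacent here      (adj ∷ _)    = adj
added-adjacent {G} (there p) (_ ∷ clique) = added-adjacent {G} p clique

ExtendsToClique : (G : Graph) → List (Vertex G) → List (Vertex G) → Set
ExtendsToClique G s t = s ⊏ t × Clique G t

-- Lists grow at the head.  Those that are not cliques are isolated vertices, so
-- that vertices carry no proofs and countability is immediate.
CliqueTree : Graph → Graph
CliqueTree G = record
  { Vertex   = List (Vertex G)
  ; Edge     = λ s t → ExtendsToClique G s t ⊎ ExtendsToClique G t s
  ; edge-sym = swap
  ; loopless = λ s → [ irrefl , irrefl ]′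
  }
  where
  irrefl : ∀ {s} → ¬ ExtendsToClique G s s
  irrefl (p , _) = <-irrefl refl (⊏-length p)

CliqueTree⟶̸ : ∀ {G} → ¬ ContainsSubgraph G Kω → CliqueTree G ⟶̸ G
CliqueTree⟶̸ {G} ¬Kω (f , f-hom) = ¬Kω (infinite-clique G (f ∘ s) (λ m<n → adjacent m<n))
  where
  s : ℕ → List (Vertex G)
  s zero    = []
  s (suc n) = f (s n) ∷ s n

  s-⊏ : ∀ {m n} → m < n → s m ⊏ s n
  s-⊏ {n = suc n} m<1+n with m≤n⇒m<n∨m≡n (s≤s⁻¹ m<1+n)
  ... | inj₁ m<n  = there (s-⊏ m<n)
  ... | inj₂ refl = here

  all-earlier : ∀ {P : Vertex G → Set} n → (∀ {m} → m < n → P (f (s m))) → All P (s n)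
  all-earlier zero    _  = []
  all-earlier (suc n) Pf = Pf (n<1+n n) ∷ all-earlier n λ m<n → Pf (<-trans m<n (n<1+n n))

  s-clique : ∀ n → Clique G (s n)
  s-clique zero    = []
  -- Since `s n` is already a clique, it is adjacent in the tree to every earlier `s m`, and `f`
  -- preserves these edges.
  s-clique (suc n) =
    all-earlier n (λ m<n → f-hom (inj₂ (s-⊏ m<n , s-clique n))) ∷ s-clique n

  adjacent : ∀ {m n} → m < n → Edge G (f (s n)) (f (s m))
  adjacent {n = n} m<n = f-hom (inj₂ (s-⊏ m<n , s-clique n))

-- The vertex added to `t k` is adjacent to all of `t k`, which contains every vertex added earlier.
infinite-branch : ∀ {G} (t : ℕ → List (Vertex G)) → (∀ k → ExtendsToClique G (t k) (t (suc k))) →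
                  ContainsSubgraph G Kω
infinite-branch {G} t up = infinite-clique G x adjacent
  where
  x : ℕ → Vertex G
  x k = added (proj₁ (up k))

  earlier-∈ : ∀ {m n} → m < n → x m ∈ t n
  earlier-∈ {m} {suc n} m<1+n with m≤n⇒m<n∨m≡n (s≤s⁻¹ m<1+n)
  ... | inj₁ m<n  = ⊏-∈ (proj₁ (up n)) (earlier-∈ m<n)
  ... | inj₂ refl = added-∈ (proj₁ (up m))

  adjacent : ∀ {m n} → m < n → Edge G (x n) (x m)
  adjacent {n = n} m<n = All.lookup (added-adjacent {G} (proj₁ (up n)) (proj₂ (up n))) (earlier-∈ m<n)

-- Shift graphs

-- Entries beyond the end of the list are 0.
entry : List ℕ → ℕ → ℕ
entry []       _       = 0
entry (x ∷ _)  zero    = x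
entry (_ ∷ xs) (suc i) = entry xs i

entry-applyUpTo : ∀ u {r i} → i < r → entry (applyUpTo u r) i ≡ u i
entry-applyUpTo u {suc r} {zero}  _   = refl
entry-applyUpTo u {suc r} {suc i} i<r = entry-applyUpTo (u ∘ suc) (s<s⁻¹ i<r)

applyUpTo-cong : ∀ {u v : ℕ → ℕ} r → (∀ {i} → i < r → u i ≡ v i) → applyUpTo u r ≡ applyUpTo v r
applyUpTo-cong zero    _   = refl
applyUpTo-cong (suc r) u≗v = cong₂ _∷_ (u≗v z<s) (applyUpTo-cong r (u≗v ∘ s<s))

Increasing : ℕ → List ℕ → Set
Increasing r u = ∀ {i} → suc i < r → entry u i < entry u (suc i)

record Shift (r : ℕ) (u v : List ℕ) : Set where
  field
    source-increasing : Increasing r u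
    target-increasing : Increasing r v
    shifted           : ∀ {i} → suc i < r → entry v i ≡ entry u (suc i)

open Shift

-- The tuples have 2 + r entries, since the shift graph on 1-tuples has a loop in
-- this encoding; a tuple is represented by any list that begins with it.
ShiftGraph : ℕ → Graph
ShiftGraph r = record
  { Vertex   = List ℕ
  ; Edge     = λ u v → Shift (2 + r) u v ⊎ Shift (2 + r) v u
  ; edge-sym = swap
  ; loopless = λ u → [ irrefl , irrefl ]′
  }
  where
  irrefl : ∀ {u} → ¬ Shift (2 + r) u u
  irrefl s = <-irrefl (shifted s 2≤) (source-increasing s 2≤)
    where
    2≤ : 1 < 2 + r
    2≤ = s<s z<s

-- Each step moves the entry one place left (`inj₁`) or right (`inj₂`), flipping the parity of its
-- position. The two bounds on `i` leave room for `n` moves in either direction.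
track-entry : ∀ r {n u v} → Walk (ShiftGraph r) n u v → ∀ {i} → n ≤ i → i + n < 2 + r →
              ∃[ j ] j < 2 + r × entry v j ≡ entry u i × parity j ≡ parity (i + n)
track-entry r [] {i} _ i+0<r rewrite +-identityʳ i = i , i+0<r , refl , refl
track-entry r (_∷_ {n} (inj₁ s) p) {suc i} n≤i bound
  rewrite +-suc i n
  with track-entry r p (s≤s⁻¹ n≤i) (<-trans (n<1+n _) (<-trans (n<1+n _) bound))
... | j , j<r , v≡ , par =
  j , j<r , trans v≡ (shifted s (≤-<-trans (m≤n⇒m≤1+n (s≤s (m≤m+n i n))) bound)) , par
track-entry r (_∷_ {n} (inj₂ s) p) {i} n≤i bound
  rewrite +-suc i n
  with track-entry r p {suc i} (m≤n⇒m≤1+n (≤-trans (n≤1+n n) n≤i)) bound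
... | j , j<r , v≡ , par =
  j , j<r , trans v≡ (sym (shifted s (≤-<-trans (m≤m+n (suc i) n) bound))) , par

edge-increasing : ∀ {r u v} → Edge (ShiftGraph r) u v → Increasing (2 + r) u
edge-increasing (inj₁ s) = source-increasing s
edge-increasing (inj₂ s) = target-increasing s

-- The entry at position n of the first vertex reappears at the end of the walk
-- at a position of parity n + n, so that position is not n.
no-odd-closed-walk : ∀ {n u} → Walk (ShiftGraph (n + n)) n u u → parity n ≢ 1ℙ
no-odd-closed-walk {n} {u} walk@(e ∷ _) n-odd
  with track-entry (n + n) walk ≤-refl (m<n⇒m<1+n (n<1+n (n + n)))
... | j , j<r , same , par = contradiction
  (trans (sym (trans (+-homo-+ n n) (p+p≡0ℙ (parity n))))
         (trans (sym par) (trans (cong parity j≡n) n-odd)))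
  λ ()
  where
  n<r : n < 2 + (n + n)
  n<r = s≤s (m≤n⇒m≤1+n (m≤m+n n n))

  -- A vertex may be any list; the first edge of the walk ensures that this one is increasing.
  increasing : ∀ {i k} → i < k → k < 2 + (n + n) → entry u i < entry u k
  increasing = increasing-below (entry u) _ (edge-increasing {n + n} e)

  j≡n : j ≡ n
  j≡n with <-cmp j n
  ... | tri< j<n _ _ = contradiction (increasing j<n n<r) (<-irrefl same)
  ... | tri≈ _ j≡n _ = j≡n
  ... | tri> _ _ n<j = contradiction (increasing n<j j<r) (<-irrefl (sym same))

window-shift : ∀ {g} → StrictMono g → ∀ r → Shift r (applyUpTo g r) (applyUpTo (g ∘ suc) r)
window-shift {g} g-mono r = record
  { source-increasing = window-increasing g-mono
  ; target-increasing = window-increasing (g-mono ∘ s<s)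
  ; shifted           = λ 1+i<r → trans (entry-applyUpTo (g ∘ suc) (<-trans (n<1+n _) 1+i<r))
                                        (sym (entry-applyUpTo g 1+i<r))
  }
  where
  window-increasing : ∀ {h} → StrictMono h → Increasing r (applyUpTo h r)
  window-increasing {h} h-mono {i} 1+i<r =
    subst₂ _<_ (sym (entry-applyUpTo h (<-trans (n<1+n i) 1+i<r))) (sym (entry-applyUpTo h 1+i<r))
      (h-mono (n<1+n i))

ShiftGraph⟶̸CliqueTree : ExcludedMiddle 0ℓ → ∀ {G} → ¬ ContainsSubgraph G Kω →
                         ∀ r → ShiftGraph r ⟶̸ CliqueTree G
ShiftGraph⟶̸CliqueTree em {G} ¬Kω r (f , f-hom) = descent-or-branch (ramsey (3 + r) rises rises-local)
  where
  open Classical em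

  image : (ℕ → ℕ) → List (Vertex G)
  image u = f (applyUpTo u (2 + r))

  -- Adjacent lists in the tree differ in length, so lengths reveal which one extends the other. Two
  -- consecutive windows of `2 + r` entries involve `3 + r` entries in all.
  rises : (ℕ → ℕ) → Bool
  rises u = does (length (image u) <? length (image (u ∘ suc)))

  rises-local : DependsOnFirst (3 + r) rises
  rises-local u≗v = cong₂ (λ s t → does (length (f s) <? length (f t)))
    (applyUpTo-cong (2 + r) (λ i<r → u≗v (m<n⇒m<1+n i<r)))
    (applyUpTo-cong (2 + r) (λ i<r → u≗v (s<s i<r)))

  ascent : ∀ {u} → StrictMono u → rises u ≡ true → ExtendsToClique G (image u) (image (u ∘ suc))
  ascent {u} u-mono up with f-hom (inj₁ (window-shift u-mono (2 + r)))
  ... | inj₁ ascends        = ascends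
  ... | inj₂ (descends , _) = contradiction
    (trans (sym up) (dec-false (_ <? _) (<-asym (⊏-length descends)))) λ ()

  descent : ∀ {u} → StrictMono u → rises u ≡ false → length (image (u ∘ suc)) < length (image u)
  descent {u} u-mono down with f-hom (inj₁ (window-shift u-mono (2 + r)))
  ... | inj₁ (ascends , _)  = contradiction
    (trans (sym down) (dec-true (_ <? _) (⊏-length ascends))) λ ()
  ... | inj₂ (descends , _) = ⊏-length descends

  -- Translation by `k`, written so that consecutive windows match definitionally.
  from : ℕ → ℕ → ℕ
  from zero    = id
  from (suc k) = from k ∘ suc

  from-mono : ∀ k → StrictMono (from k)
  from-mono zero    = id
  from-mono (suc k) = from-mono k ∘ s<s

  descent-or-branch : ¬ (Σ[ g ∈ (ℕ → ℕ) ] StrictMono g × Σ[ b ∈ Bool ]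
                          (∀ {v} → StrictMono v → rises (g ∘ v) ≡ b))
  descent-or-branch (g , g-mono , true , homogeneous) =
    ¬Kω (infinite-branch {G} (λ k → image (g ∘ from k))
      λ k → ascent (g-mono ∘ from-mono k) (homogeneous (from-mono k)))
  descent-or-branch (g , g-mono , false , homogeneous) =
    no-infinite-descent (λ k → length (image (g ∘ from k)))
      λ k → descent (g-mono ∘ from-mono k) (homogeneous (from-mono k))

-- Bipartite graphs and the equivalence

bipartite⟶ : ∀ {G H x y} → Bipartite G → Edge H x y → G ⟶ H
bipartite⟶ {G} {H} {x} {y} (c , c-proper) e = (λ v → if c v then x else y) , hom
  where
  hom : IsHom G H (λ v → if c v then x else y)
  hom {v} {w} d with c v | c w | c-proper d
  ... | true  | true  | ≢ = contradiction refl ≢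
  ... | true  | false | _ = e
  ... | false | true  | _ = edge-sym H e
  ... | false | false | ≢ = contradiction refl ≢

-- Any edge of `H` receives `G`; an edgeless `H` collapses to a vertex of `G`; an empty `G` maps to
-- everything.
bipartite-comparable : ExcludedMiddle 0ℓ → ∀ {G H} → Bipartite G → ¬ Independent G H
bipartite-comparable em {G} {H} bip (G⟶̸H , H⟶̸G)
  with em {∃[ x ] ∃[ y ] Edge H x y} | em {Vertex G}
... | yes (_ , _ , e) | _     = G⟶̸H (bipartite⟶ {G} {H} bip e)
... | no edgeless     | yes v = H⟶̸G (const v , λ {x} {y} e → contradiction (x , y , e) edgeless)
... | no _            | no ¬v = G⟶̸H ((λ v → contradiction v ¬v) , λ {x} _ → contradiction x ¬v)

theorem1 : ExcludedMiddle 0ℓ → (G : Graph) → Countable G →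
    (Σ Graph λ G′ → Countable G′ × Independent G G′)
    ⇔ (¬ Bipartite G × ¬ ContainsSubgraph G Kω)
theorem1 em G G-countable = mk⇔ necessary sufficient
  where
  necessary : (Σ Graph λ G′ → Countable G′ × Independent G G′) →
              ¬ Bipartite G × ¬ ContainsSubgraph G Kω
  necessary (G′ , G′-countable , independent) =
    (λ bip → bipartite-comparable em {G} {G′} bip independent) ,
    λ (f , _ , f-hom) →
      proj₂ independent (⟶-trans {G′} {Kω} {G} (countable⟶Kω {G′} G′-countable) (f , f-hom))

  sufficient : ¬ Bipartite G × ¬ ContainsSubgraph G Kω →
               Σ Graph λ G′ → Countable G′ × Independent G G′
  sufficient (¬bip , ¬Kω) with em {G ⟶ CliqueTree G}
  ... | no  G⟶̸T = CliqueTree G , List-countable G-countable , G⟶̸T , CliqueTree⟶̸ {G} ¬Kω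
  ... | yes G⟶T with Classical.odd-closed-walk em G G-countable ¬bip
  -- The tuple length is chosen from the odd closed walk of `G`, whose image in `S` would be a
  -- closed walk of the same odd length `n`.
  ... | n , x , walk , n-odd = S , List-countable (mk↣ {to = id} id) ,
    (λ G⟶S → no-odd-closed-walk (mapʷ G⟶S walk) n-odd) ,
    (λ S⟶G → ShiftGraph⟶̸CliqueTree em {G} ¬Kω (n + n) (⟶-trans {S} {G} {CliqueTree G} S⟶G G⟶T))
    where
    S : Graph
    S = ShiftGraph (n + n)
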